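{- A countable linear ordering $(L,<)$ has a $\Sigma^{\mathrm{in}}_3$ Scott sentence if and only if its adjacency relation $\{(a,b)\in L^2 : a<b \text{ and there is no } c \text{ with } a<c<b\}$ is finite.
   Context: Infinitary formulas: $\Sigma^{\mathrm{in}}_0=\Pi^{\mathrm{in}}_0$ are the finitary quantifier-free formulas; for $\alpha\ge1$, a $\Sigma^{\mathrm{in}}_\alpha$ formula is a countable disjunction of formulas $\exists\bar x\,\varphi$ with $\varphi\in\Pi^{\mathrm{in}}_\beta$, $\beta<\alpha$, and $\Pi^{\mathrm{in}}_\alpha$ is dual. A Scott sentence of a countable structure is an $L_{\omega_1\omega}$ sentence whose countable models are exactly its isomorphic copies. -}

module Defs where

open import Data.Nat using (ℕ; zero; suc; _+_; _≤_)
open import Data.Fin using (Fin)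
open import Data.Product using (Σ; _×_; _,_)
open import Data.Sum using (_⊎_)
open import Data.Empty using (⊥)
open import Data.Unit using (⊤)
open import Data.List using (List)
open import Data.List.Membership.Propositional using (_∈_)
open import Data.Vec.Functional using (Vector; _++_)
open import Relation.Nullary using (¬_)
open import Relation.Binary.PropositionalEquality using (_≡_)
open import Function.Bundles using (_↣_; _⤖_; _⇔_; Bijection)

record Structure : Set₁ where
  field
    Carrier   : Set
    R         : Carrier → Carrier → Set
    countable : Carrier ↣ ℕ
open Structure public

_≅_ : Structure → Structure → Set
M ≅ N = Σ (Carrier M ⤖ Carrier N) λ f →
  ∀ a b → R M a b ⇔ R N (Bijection.to f a) (Bijection.to f b)

data QF (m : ℕ) : Set where
  ⊤ᶠ ⊥ᶠ : QF m
  lt eq : Fin m → Fin m → QF m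
  ¬ᶠ    : QF m → QF m
  _∧ᶠ_ _∨ᶠ_ : QF m → QF m → QF m

-- Σ^in_n and Π^in_n formulas (finite levels), free variables among Fin m.
-- A countable disjunction is indexed by ℕ (finite ones by repetition; the
-- empty disjunction is equivalent to ⊥ᶠ, which is quantifier-free).
-- The i-th disjunct is ∃ x̄ φ_i with x̄ a block of (k i) variables and
-- φ_i ∈ Π^in_(β i), β i < n+1.  Bound variables come first (de Bruijn).
mutual
  data Sig : ℕ → ℕ → Set where
    qfΣ : ∀ {m} → QF m → Sig zero m
    ⋁∃  : ∀ {n m} (k β : ℕ → ℕ) → (∀ i → β i ≤ n) →
          ((i : ℕ) → Pi (β i) (k i + m)) → Sig (suc n) m
  data Pi : ℕ → ℕ → Set where
    qfΠ : ∀ {m} → QF m → Pi zero m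
    ⋀∀  : ∀ {n m} (k β : ℕ → ℕ) → (∀ i → β i ≤ n) →
          ((i : ℕ) → Sig (β i) (k i + m)) → Pi (suc n) m

module _ (M : Structure) where
  qfSat : ∀ {m} → Vector (Carrier M) m → QF m → Set
  qfSat ρ ⊤ᶠ = ⊤
  qfSat ρ ⊥ᶠ = ⊥
  qfSat ρ (lt x y) = R M (ρ x) (ρ y)
  qfSat ρ (eq x y) = ρ x ≡ ρ y
  qfSat ρ (¬ᶠ φ) = ¬ qfSat ρ φ
  qfSat ρ (φ ∧ᶠ ψ) = qfSat ρ φ × qfSat ρ ψ
  qfSat ρ (φ ∨ᶠ ψ) = qfSat ρ φ ⊎ qfSat ρ ψ

  mutual
    sigSat : ∀ {n m} → Vector (Carrier M) m → Sig n m → Set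
    sigSat ρ (qfΣ φ) = qfSat ρ φ
    sigSat ρ (⋁∃ k β _ φ) =
      Σ ℕ λ i → Σ (Vector (Carrier M) (k i)) λ v → piSat (v ++ ρ) (φ i)

    piSat : ∀ {n m} → Vector (Carrier M) m → Pi n m → Set
    piSat ρ (qfΠ φ) = qfSat ρ φ
    piSat ρ (⋀∀ k β _ φ) =
      (i : ℕ) → (v : Vector (Carrier M) (k i)) → sigSat (v ++ ρ) (φ i)

emptyAssignment : {A : Set} → Vector A zero
emptyAssignment ()

_⊨_ : ∀ {n} → Structure → Sig n zero → Set
M ⊨ φ = sigSat M emptyAssignment φ

IsScottSentence : ∀ {n} → Sig n zero → Structure → Set₁
IsScottSentence φ L = (M : Structure) → (M ⊨ φ) ⇔ (M ≅ L)

HasΣ3ScottSentence : Structure → Set₁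
HasΣ3ScottSentence L = Σ (Sig 3 zero) λ φ → IsScottSentence φ L

Adjacent : (L : Structure) → Carrier L → Carrier L → Set
Adjacent L a b = R L a b × ¬ (Σ (Carrier L) λ c → R L a c × R L c b)

AdjacencyFinite : Structure → Set
AdjacencyFinite L = Σ (List (Carrier L × Carrier L)) λ xs →
  ∀ a b → Adjacent L a b → (a , b) ∈ xs

{-# OPTIONS --safe #-}

-- Suppose L satisfies a Σ₃ Scott sentence, with witnesses a for its leading
-- existential block.  Add to a the finite order-classes over a, obtaining a
-- finite F, and let N arise from L by blowing up each point outside F to a copy
-- of ℚ.  Every finite tuple of N has the same order type over F as some tuple of
-- L (each class that is blown up is infinite, so it contains arbitrarily long
-- chains), and an interval of N that is empty comes from an empty interval of L
-- with end points in F.  So the Π₂ matrix is still true of a in N, whence N ≅ L;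
-- but adjacent points of N lie in F.
--
-- Conversely, if all adjacent points and end points of L belong to a finite F,
-- then L is homogeneous over F.  A Scott sentence then says that some tuple has
-- the quantifier-free type of F and that any two tuples with equal types over it
-- satisfy the back-and-forth conditions.

module Submission where

open import Defs
open import Relation.Nullary using (Dec; yes; no; does; ¬_)
open import Relation.Binary.PropositionalEquality
  using (_≡_; _≢_; refl; sym; trans; cong; cong₂; subst; subst₂; isEquivalence; resp₂)
open import Relation.Binary.Structures using (IsStrictTotalOrder)
open import Function.Bundles using (_⇔_; mk↣; mk⤖; mk⇔; Equivalence; Injection; Bijection)

open import Axiom.UniquenessOfIdentityProofs using (module Decidable⇒UIP)
open import Data.Bool.Base using (if_then_else_)
open import Data.Empty using (⊥-elim)
open import Data.Fin.Base using (Fin; zero; suc; splitAt; _↑ˡ_; _↑ʳ_)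
open import Data.Integer.Base using (ℤ; +_; -[1+_])
open import Data.List.Base as List using (List; []; _∷_; length)
open import Data.List.Membership.Propositional using (_∈_; _∉_; find; lose)
open import Data.List.Membership.Propositional.Properties
open import Data.List.Relation.Unary.All as All using ([]; _∷_)
open import Data.List.Relation.Unary.AllPairs using (AllPairs; []; _∷_)
open import Data.List.Relation.Unary.Any using (here; there; index)
open import Data.List.Relation.Unary.Any.Properties using (lookup-index)
open import Data.Maybe.Base as Maybe using (Maybe; just; nothing)
open import Data.Maybe.Relation.Binary.Pointwise using (Pointwise; just; nothing)
open import Data.Nat.Base as ℕ using (ℕ; zero; suc; _≤_; _<_; z≤n; s≤s; s≤s⁻¹; _⊔_)
import Data.Nat.Properties as ℕₚ
open import Data.Product using (Σ; ∃; ∃₂; _×_; _,_; proj₁; proj₂)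
open import Data.Rational.Base as ℚ using (ℚ; mkℚ; 0ℚ; 1ℚ)
import Data.Rational.Properties as ℚₚ
open import Data.Sum using (_⊎_; inj₁; inj₂)
open import Data.Unit using (⊤; tt)
open import Data.Vec.Base as Vec using (Vec)
open import Data.Vec.Functional as VF using (Vector; _++_)
open import Data.Vec.Functional.Properties using (lookup-++ʳ; lookup-++ˡ)
open import Data.Vec.Functional.Relation.Binary.Pointwise.Properties using (++⁺)
open import Function.Base using (_∘_; id; const; flip)
import Function.Properties.Equivalence as ⇔
open import Function.Related.TypeIsomorphisms using (¬-cong-⇔)
import Relation.Binary.Construct.Flip.EqAndOrd as Flip
open import Relation.Binary.Definitions using (Tri; tri<; tri≈; tri>)

open Equivalence using (to; from)

private variable
  A B : Structure

STO : Structure → Set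
STO A = IsStrictTotalOrder _≡_ (R A)

-- Codings into ℕ

-- With s = a + b, the code lies in [s², (s + 1)²) and so determines s.
pair : ℕ → ℕ → ℕ
pair a b = (a ℕ.+ b) ℕ.* (a ℕ.+ b) ℕ.+ a

private
  pair-sum : ∀ {a b c d} → a ℕ.+ b < c ℕ.+ d → pair a b < pair c d
  pair-sum {a} {b} {c} {d} x<y = begin-strict
    s ℕ.* s ℕ.+ a          ≤⟨ ℕₚ.+-monoʳ-≤ (s ℕ.* s) (ℕₚ.m≤m+n a b) ⟩
    s ℕ.* s ℕ.+ s          ≡⟨ ℕₚ.+-comm (s ℕ.* s) s ⟩
    suc s ℕ.* s            <⟨ ℕₚ.*-monoʳ-< (suc s) (ℕₚ.n<1+n s) ⟩
    suc s ℕ.* suc s        ≤⟨ ℕₚ.*-mono-≤ x<y x<y ⟩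
    t ℕ.* t                ≤⟨ ℕₚ.m≤m+n (t ℕ.* t) c ⟩
    t ℕ.* t ℕ.+ c          ∎
    where
    open ℕₚ.≤-Reasoning
    s = a ℕ.+ b
    t = c ℕ.+ d

-- Different sums give different codes by `pair-sum`; for equal sums the square cancels, leaving the
-- first coordinate and then the second.
pair-injective : ∀ {a b c d} → pair a b ≡ pair c d → a ≡ c × b ≡ d
pair-injective {a} {b} {c} {d} eq′ with ℕₚ.<-cmp (a ℕ.+ b) (c ℕ.+ d)
... | tri< x<y _ _ = ⊥-elim (ℕₚ.<⇒≢ (pair-sum {a} {b} {c} {d} x<y) eq′)
... | tri> _ _ gt = ⊥-elim (ℕₚ.<⇒≢ (pair-sum {c} {d} {a} {b} gt) (sym eq′))
... | tri≈ _ e _ with ℕₚ.+-cancelˡ-≡ ((a ℕ.+ b) ℕ.* (a ℕ.+ b)) a c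
                        (trans eq′ (cong (λ s → s ℕ.* s ℕ.+ c) (sym e)))
... | refl = refl , ℕₚ.+-cancelˡ-≡ a b d e

ℤ-code : ℤ → ℕ
ℤ-code (+ n)    = pair 0 n
ℤ-code -[1+ n ] = pair 1 n

ℤ-code-injective : ∀ i j → ℤ-code i ≡ ℤ-code j → i ≡ j
ℤ-code-injective (+ m) (+ n) e = cong +_ (proj₂ (pair-injective {0} {m} {0} {n} e))
ℤ-code-injective (+ m) -[1+ n ] e with () ← proj₁ (pair-injective {0} {m} {1} {n} e)
ℤ-code-injective -[1+ m ] (+ n) e with () ← proj₁ (pair-injective {1} {m} {0} {n} e)
ℤ-code-injective -[1+ m ] -[1+ n ] e = cong -[1+_] (proj₂ (pair-injective {1} {m} {1} {n} e))

ℚ-code : ℚ → ℕ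
ℚ-code (mkℚ n d _) = pair (ℤ-code n) d

ℚ-code-injective : ∀ p q → ℚ-code p ≡ ℚ-code q → p ≡ q
ℚ-code-injective (mkℚ n d _) (mkℚ n′ d′ _) e
  with en , refl ← pair-injective {ℤ-code n} {d} {ℤ-code n′} {d′} e
  with refl ← ℤ-code-injective n n′ en = refl

vec-code : {X : Set} → (X → ℕ) → ∀ {n} → Vec X n → ℕ
vec-code f Vec.[]       = 0
vec-code f (x Vec.∷ xs) = pair (f x) (vec-code f xs)

-- Injective for each fixed length only: `pair 0 0` is also 0, the code of the empty vector. Codes
-- that mix lengths record the length separately.
vec-code-injective : ∀ {X : Set} (f : X → ℕ) → (∀ {x y} → f x ≡ f y → x ≡ y) →
  ∀ {n} (xs ys : Vec X n) → vec-code f xs ≡ vec-code f ys → xs ≡ ys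
vec-code-injective f inj Vec.[] Vec.[] _ = refl
vec-code-injective f inj (x Vec.∷ xs) (y Vec.∷ ys) e
  with ex , exs ← pair-injective {f x} {vec-code f xs} {f y} {vec-code f ys} e
  = cong₂ Vec._∷_ (inj ex) (vec-code-injective f inj xs ys exs)

-- Agreement of tuples and transfer of formulas

module _ (A B : Structure) where

  Agree : Carrier A × Carrier B → Carrier A × Carrier B → Set
  Agree (x , y) (x′ , y′) = (R A x x′ ⇔ R B y y′) × (x ≡ x′ ⇔ y ≡ y′)

  Match : ∀ {m} → Vector (Carrier A) m → Vector (Carrier B) m → Set
  Match ρ ρ′ = ∀ i j → Agree (ρ i , ρ′ i) (ρ j , ρ′ j)

  -- The graph of a finite partial isomorphism. The equality half of `Agree` makes it single-valued
  -- and injective.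
  Consistent : List (Carrier A × Carrier B) → Set
  Consistent P = ∀ {p q} → p ∈ P → q ∈ P → Agree p q

Agree-flip : ∀ {x y x′ y′} → Agree A B (x , y) (x′ , y′) → Agree B A (y , x) (y′ , x′)
Agree-flip (r , e) = ⇔.sym r , ⇔.sym e

Match-resp : ∀ {m} {ρ σ : Vector (Carrier A) m} {ρ′ σ′ : Vector (Carrier B) m} →
  (∀ i → ρ i ≡ σ i) → (∀ i → ρ′ i ≡ σ′ i) → Match A B ρ ρ′ → Match A B σ σ′
Match-resp {A} {B} e e′ M i j =
  subst₂ (Agree A B) (cong₂ _,_ (e i) (e′ i)) (cong₂ _,_ (e j) (e′ j)) (M i j)

qf-transfer : ∀ {m} {ρ : Vector (Carrier A) m} {ρ′ : Vector (Carrier B) m} →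
  Match A B ρ ρ′ → (φ : QF m) → qfSat A ρ φ ⇔ qfSat B ρ′ φ
qf-transfer M ⊤ᶠ = mk⇔ id id
qf-transfer M ⊥ᶠ = mk⇔ id id
qf-transfer M (lt x y) = proj₁ (M x y)
qf-transfer M (eq x y) = proj₂ (M x y)
qf-transfer M (¬ᶠ φ) = ¬-cong-⇔ (qf-transfer M φ)
qf-transfer M (φ ∧ᶠ ψ) = let e = qf-transfer M φ; e′ = qf-transfer M ψ in
  mk⇔ (λ (p , q) → to e p , to e′ q) (λ (p , q) → from e p , from e′ q)
qf-transfer M (φ ∨ᶠ ψ) = let e = qf-transfer M φ; e′ = qf-transfer M ψ in
  mk⇔ (λ { (inj₁ p) → inj₁ (to e p) ; (inj₂ q) → inj₂ (to e′ q) })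
      (λ { (inj₁ p) → inj₁ (from e p) ; (inj₂ q) → inj₂ (from e′ q) })

-- An isomorphism as a relation: back and forth produces it in this form, and inversion is just
-- `flip`. That it is a bijective function is hidden in the equality half of `agree`.
record IsoRel (A B : Structure) (G : Carrier A → Carrier B → Set) : Set where
  field
    total : ∀ x → ∃ λ y → G x y
    onto  : ∀ y → ∃ λ x → G x y
    agree : ∀ {x y x′ y′} → G x y → G x′ y′ → Agree A B (x , y) (x′ , y′)

IsoRel-flip : ∀ {G} → IsoRel A B G → IsoRel B A (flip G)
IsoRel-flip {A} {B} I = record
  { total = onto ; onto = total ; agree = λ g h → Agree-flip {A} {B} (agree g h) }
  where open IsoRel I

IsoRel⇒≅ : ∀ {G} → IsoRel A B G → A ≅ B
IsoRel⇒≅ {A} {B} {G} I =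
  mk⤖ {to = f} ( (λ {x} {x′} e → from (proj₂ (agree (f-G x) (f-G x′))) e)
               , λ y → proj₁ (onto y) , λ { refl → to (proj₂ (agree (f-G _) (proj₂ (onto y)))) refl }) ,
  λ a b → proj₁ (agree (f-G a) (f-G b))
  where
  open IsoRel I
  f : Carrier A → Carrier B
  f x = proj₁ (total x)
  f-G : ∀ x → G x (f x)
  f-G x = proj₂ (total x)

≅⇒IsoRel : (I : A ≅ B) → IsoRel A B (λ x y → Bijection.to (proj₁ I) x ≡ y)
≅⇒IsoRel (f , pres) = record
  { total = λ x → _ , refl
  ; onto  = λ y → proj₁ (Bijection.surjective f y) , proj₂ (Bijection.surjective f y) refl
  ; agree = λ { refl refl → pres _ _ , mk⇔ (cong (Bijection.to f)) (Bijection.injective f) } }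

module _ {A B : Structure} {G : Carrier A → Carrier B → Set} (I : IsoRel A B G) where
  open IsoRel I

  mutual
    -- Existential witnesses are pushed forward by `total`, universal challenges pulled back by
    -- `onto`. Relating the assignments by `G` lets both moves keep the same invariant.
    sig-iso : ∀ {n m} {ρ : Vector (Carrier A) m} {ρ′ : Vector (Carrier B) m} →
      (∀ i → G (ρ i) (ρ′ i)) → (σ : Sig n m) → sigSat A ρ σ → sigSat B ρ′ σ
    sig-iso g (qfΣ φ) s = to (qf-transfer (λ i j → agree (g i) (g j)) φ) s
    sig-iso g (⋁∃ k β _ φ) (i , v , s) =
      i , (λ j → proj₁ (total (v j))) , pi-iso (++⁺ G (λ j → proj₂ (total (v j))) g) (φ i) s

    pi-iso : ∀ {n m} {ρ : Vector (Carrier A) m} {ρ′ : Vector (Carrier B) m} →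
      (∀ i → G (ρ i) (ρ′ i)) → (π : Pi n m) → piSat A ρ π → piSat B ρ′ π
    pi-iso g (qfΠ φ) s = to (qf-transfer (λ i j → agree (g i) (g j)) φ) s
    pi-iso g (⋀∀ k β _ φ) s i v =
      sig-iso (++⁺ G (λ j → proj₂ (onto (v j))) g) (φ i) (s i (λ j → proj₁ (onto (v j))))

-- Extension of partial isomorphisms between linear orders

-- Bounds range over Maybe: nothing stands for -∞ as a lower and for +∞ as an
-- upper bound.

Above : (A : Structure) → Maybe (Carrier A) → Carrier A → Set
Above A nothing  w = ⊤
Above A (just x) w = R A x w

op : Structure → Structure
op A = record { Carrier = Carrier A ; R = flip (R A) ; countable = countable A }

Between : (A : Structure) → Maybe (Carrier A) → Maybe (Carrier A) → Carrier A → Set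
Between A l h w = Above A l w × Above (op A) h w

Empty : (A : Structure) → Maybe (Carrier A) → Maybe (Carrier A) → Set
Empty A l h = ¬ ∃ (Between A l h)

-- Rules out reversed or coinciding end points, between which emptiness carries no information.
data Bounds (A : Structure) : Maybe (Carrier A) → Maybe (Carrier A) → Set where
  -∞,  : ∀ {h} → Bounds A nothing h
  ,+∞  : ∀ {l} → Bounds A l nothing
  bnd  : ∀ {x y} → R A x y → Bounds A (just x) (just y)

-- The obstruction to extending a partial isomorphism from `A` to `B` is an empty gap in `B`. Here
-- each such gap comes from an empty gap of `A` with corresponding end points in `Base`.
ReflectsEmpty : (A B : Structure) → (Carrier A → Carrier B → Set) → Set
ReflectsEmpty A B Base = ∀ {l h} → Bounds B l h → Empty B l h →
  ∃₂ λ l′ h′ → Pointwise Base l′ l × Pointwise Base h′ h × Empty A l′ h′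

module _ {A B : Structure} (sA : STO A) (sB : STO B) where
  private
    module A = IsStrictTotalOrder sA
    module B = IsStrictTotalOrder sB

  -- Trichotomy in `A`, with irreflexivity and transitivity in `B`, upgrades the one-way
  -- implications to equivalences.
  consistent : ∀ {P} →
    (∀ {p q} → p ∈ P → q ∈ P → R A (proj₁ p) (proj₁ q) → R B (proj₂ p) (proj₂ q)) →
    (∀ {p q} → p ∈ P → q ∈ P → proj₁ p ≡ proj₁ q → proj₂ p ≡ proj₂ q) →
    Consistent A B P
  consistent mono well {x , y} {x′ , y′} p q with A.compare x x′
  ... | tri< x<y ¬e _ = let lt′ = mono p q x<y in
    mk⇔ (λ _ → lt′) (λ _ → x<y) ,
    mk⇔ (⊥-elim ∘ ¬e) (λ e → ⊥-elim (B.irrefl e lt′))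
  ... | tri≈ x≮y e _ = let e′ = well p q e in
    mk⇔ (⊥-elim ∘ x≮y) (λ r → ⊥-elim (B.irrefl e′ r)) , mk⇔ (λ _ → e′) (λ _ → e)
  ... | tri> x≮y ¬e gt = let gt′ = mono q p gt in
    mk⇔ (⊥-elim ∘ x≮y) (λ r → ⊥-elim (B.irrefl refl (B.trans r gt′))) ,
    mk⇔ (⊥-elim ∘ ¬e) (λ e → ⊥-elim (B.irrefl (sym e) gt′))

  -- Finds the pair with the greatest image among those whose source is below `d`. Maximality is
  -- phrased through points above `l`, so that -∞ needs no special treatment; on `op A` and `op B`
  -- the same lemma yields the nearest bound from above.
  max-below : ∀ d (P : List (Carrier A × Carrier B)) →
    ∃₂ λ l′ l → Pointwise (λ x y → (x , y) ∈ P) l′ l × Above A l′ d ×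
      (∀ {x y} → (x , y) ∈ P → R A x d → ∀ {w} → Above B l w → R B y w)
  max-below d [] = nothing , nothing , nothing , tt , λ ()
  max-below d ((x , y) ∷ P) with max-below d P | x A.<? d
  ... | l′ , l , m , ab , mx | no x≮y =
    l′ , l , weaken m , ab , λ { (here refl) r → ⊥-elim (x≮y r) ; (there p) → mx p }
    where
    weaken : ∀ {u v} → Pointwise (λ x y → (x , y) ∈ P) u v → Pointwise (λ x′ y′ → (x′ , y′) ∈ (x , y) ∷ P) u v
    weaken nothing  = nothing
    weaken (just p) = just (there p)
  ... | nothing , nothing , nothing , ab , mx | yes x<y =
    just x , just y , just (here refl) , x<y ,
    λ { (here refl) _ r → r ; (there p) r _ → mx p r tt }
  ... | just x₀ , just y₀ , just m , ab , mx | yes x<y with B.compare y₀ y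
  ...   | tri< lt₀ _ _ = just x , just y , just (here refl) , x<y ,
    λ { (here refl) _ r → r ; (there p) r s → mx p r (B.trans lt₀ s) }
  ...   | tri≈ _ refl _ = just x₀ , just y₀ , just (there m) , ab ,
    λ { (here refl) _ r → r ; (there p) r s → mx p r s }
  ...   | tri> _ _ gt = just x₀ , just y₀ , just (there m) , ab ,
    λ { (here refl) _ r → B.trans gt r ; (there p) r s → mx p r s }

module _ (em : (P : Set) → Dec P) {A B : Structure} (sA : STO A) (sB : STO B)
  {Base : Carrier A → Carrier B → Set} (H : ReflectsEmpty A B Base) where
  private
    module A = IsStrictTotalOrder sA
    module B = IsStrictTotalOrder sB

  -- A new `d` goes to any point of the gap of `B` between the images of its neighbours. Were that
  -- gap empty, so would be the gap of `A` between the neighbours themselves, by `H`; but it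
  -- contains `d`.
  extend : ∀ P → (∀ {x y} → Base x y → (x , y) ∈ P) → Consistent A B P →
    ∀ d → ∃ λ w → Consistent A B ((d , w) ∷ P)
  extend P base cons d with em (∃ λ w → (d , w) ∈ P)
  ... | yes (w , dw∈P) = w , λ p q → cons (shrink p) (shrink q)
    where
    shrink : ∀ {p} → p ∈ (d , w) ∷ P → p ∈ P
    shrink (here refl) = dw∈P
    shrink (there p)   = p
  ... | no d∉P
    with l′ , l , ml , al , mx ← max-below {A} {B} sA sB d P
       | h′ , h , mh , ah , mn ← max-below {op A} {op B} (Flip.isStrictTotalOrder sA) (Flip.isStrictTotalOrder sB) d P
    with em (∃ (Between B l h))
  ... | yes (w , lw , wh) = w , consistent {A} {B} sA sB mono well
    where
    mono : ∀ {p q} → p ∈ (d , w) ∷ P → q ∈ (d , w) ∷ P → R A (proj₁ p) (proj₁ q) → R B (proj₂ p) (proj₂ q)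
    mono (here refl) (here refl) r = ⊥-elim (A.irrefl refl r)
    mono (here refl) (there q) r = mn q r wh
    mono (there p) (here refl) r = mx p r lw
    mono (there p) (there q) r = to (proj₁ (cons p q)) r
    well : ∀ {p q} → p ∈ (d , w) ∷ P → q ∈ (d , w) ∷ P → proj₁ p ≡ proj₁ q → proj₂ p ≡ proj₂ q
    well (here refl) (here refl) _ = refl
    well (here refl) (there q) refl = ⊥-elim (d∉P (_ , q))
    well (there p) (here refl) refl = ⊥-elim (d∉P (_ , p))
    well (there p) (there q) e = to (proj₂ (cons p q)) e
  ... | no none =
    let l″ , h″ , bl , bh , empty = H (bounds ml mh al ah) none in
    ⊥-elim (empty (d , subst (λ z → Above A z d) (same ml bl) al , subst (λ z → Above (op A) z d) (same mh bh) ah))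
    where
    bounds : ∀ {l′ l h′ h} → Pointwise (λ x y → (x , y) ∈ P) l′ l → Pointwise (λ x y → (x , y) ∈ P) h′ h →
      Above A l′ d → Above (op A) h′ d → Bounds B l h
    bounds nothing _ _ _ = -∞,
    bounds (just _) nothing _ _ = ,+∞
    bounds (just p) (just q) a b = bnd (to (proj₁ (cons p q)) (A.trans a b))
    -- `H` supplies end points through `Base`; as `P` is injective, they are the neighbours of `d`.
    same : ∀ {u v z} → Pointwise (λ x y → (x , y) ∈ P) u z → Pointwise Base v z → u ≡ v
    same nothing nothing = refl
    same (just p) (just b) = cong just (from (proj₂ (cons p (base b))) refl)

  extend* : ∀ k (v : Vector (Carrier A) k) P → (∀ {x y} → Base x y → (x , y) ∈ P) → Consistent A B P →
    ∃₂ λ Q (w : Vector (Carrier B) k) → Consistent A B Q × (∀ {p} → p ∈ P → p ∈ Q) × (∀ i → (v i , w i) ∈ Q)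
  extend* zero v P base cons = P , (λ ()) , cons , id , λ ()
  extend* (suc k) v P base cons
    with Q , w , cQ , P⊆Q , vw ← extend* k (v ∘ suc) P base cons
    with y , cQ′ ← extend Q (P⊆Q ∘ base) cQ (v zero)
    = (v zero , y) ∷ Q , y VF.∷ w , cQ′ , there ∘ P⊆Q , λ { zero → here refl ; (suc i) → there (vw i) }

module _ (em : (P : Set) → Dec P) {A B : Structure} (sA : STO A) (sB : STO B)
  {Base : Carrier A → Carrier B → Set} (H : ReflectsEmpty A B Base)
  {P : List (Carrier A × Carrier B)} (base : ∀ {x y} → Base x y → (x , y) ∈ P)
  (cons : Consistent A B P) where

  -- The witnesses of the existential block are carried over by `extend*`. Truth passes from `A` to
  -- `B` only, matching the direction of `H`.
  sig₁-transfer : ∀ {n m} → n ≤ 1 → {ρ : Vector (Carrier A) m} {ρ′ : Vector (Carrier B) m} →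
    (∀ i → (ρ i , ρ′ i) ∈ P) → (σ : Sig n m) → sigSat A ρ σ → sigSat B ρ′ σ
  sig₁-transfer _ m (qfΣ φ) s = to (qf-transfer (λ i j → cons (m i) (m j)) φ) s
  sig₁-transfer {m = l} n≤1 {ρ} {ρ′} m (⋁∃ k β β≤ φ) (i , v , s)
    with Q , w , cQ , P⊆Q , vw ← extend* em sA sB H (k i) v P base cons
    = i , w , pi₀ (φ i) (ℕₚ.≤-trans (β≤ i) (s≤s⁻¹ n≤1)) s
    where
    pi₀ : ∀ {b} (π : Pi b (k i ℕ.+ l)) → b ≤ 0 → piSat A (v ++ ρ) π → piSat B (w ++ ρ′) π
    -- Level 0 leaves only the quantifier-free case.
    pi₀ (qfΠ φ) _ s = to (qf-transfer (λ i j → cQ (mem i) (mem j)) φ) s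
      where mem = ++⁺ (λ x y → (x , y) ∈ Q) vw (P⊆Q ∘ m)

-- An adjacent pair bounds an empty gap, so both of its points are images of elements of `F`.
reflectsEmpty⇒adjacencyFinite : {A B : Structure} (F : List (Carrier A)) (f : Carrier A → Carrier B) →
  ReflectsEmpty A B (λ x y → x ∈ F × f x ≡ y) → AdjacencyFinite B
reflectsEmpty⇒adjacencyFinite {A} {B} F f H = List.cartesianProduct fF fF , adj
  where
  fF = List.map f F
  adj : ∀ a b → Adjacent B a b → (a , b) ∈ List.cartesianProduct fF fF
  adj a b (a<b , none) with _ , _ , just (x∈F , refl) , just (y∈F , refl) , _ ← H (bnd a<b) none
    = ∈-cartesianProduct⁺ (∈-map⁺ f x∈F) (∈-map⁺ f y∈F)

-- Ranks and chains

module Chains (A : Structure) (sA : STO A) where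
  private
    module A = IsStrictTotalOrder sA

  -- Used twice: over the parameters it identifies the cut in which a point lies, and over a finite
  -- list of points it gives positions in a chain.
  rank : List (Carrier A) → Carrier A → ℕ
  rank []       x = 0
  rank (a ∷ as) x with a A.<? x
  ... | yes _ = suc (rank as x)
  ... | no  _ = rank as x

  rank≤length : ∀ as x → rank as x ≤ length as
  rank≤length []       x = z≤n
  rank≤length (a ∷ as) x with a A.<? x
  ... | yes _ = s≤s (rank≤length as x)
  ... | no  _ = ℕₚ.m≤n⇒m≤1+n (rank≤length as x)

  private
    rank-mono′ : ∀ as {x y} → (∀ {b} → R A b x → R A b y) → rank as x ≤ rank as y
    rank-mono′ []       h = z≤n
    rank-mono′ (a ∷ as) {x} {y} h with a A.<? x | a A.<? y
    ... | yes _   | yes _   = s≤s (rank-mono′ as h)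
    ... | yes a<x | no  a≮y = ⊥-elim (a≮y (h a<x))
    ... | no  _   | yes _   = ℕₚ.m≤n⇒m≤1+n (rank-mono′ as h)
    ... | no  _   | no  _   = rank-mono′ as h

  rank-mono : ∀ as {x y} → R A x y → rank as x ≤ rank as y
  rank-mono as x<y = rank-mono′ as (λ b<x → A.trans b<x x<y)

  -- Everything counted for `x` is counted for `y`, and `a` is counted for `y` alone.
  rank-strict : ∀ {as a x y} → a ∈ as → ¬ R A a x → R A a y → R A x y → rank as x < rank as y
  rank-strict {a ∷ as} {x = x} {y} (here refl) a≮x a<y x<y with a A.<? x | a A.<? y
  ... | yes a<x | _       = ⊥-elim (a≮x a<x)
  ... | no  _   | no  a≮y = ⊥-elim (a≮y a<y)
  ... | no  _   | yes _   = s≤s (rank-mono as x<y)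
  rank-strict {a ∷ as} {x = x} {y} (there p) ≮x <y x<y with a A.<? x | a A.<? y
  ... | yes _   | yes _   = s≤s (rank-strict p ≮x <y x<y)
  ... | yes a<x | no  a≮y = ⊥-elim (a≮y (A.trans a<x x<y))
  ... | no  _   | yes _   = ℕₚ.m≤n⇒m≤1+n (rank-strict p ≮x <y x<y)
  ... | no  _   | no  _   = rank-strict p ≮x <y x<y

  rank-reflects : ∀ as {x y} → rank as x < rank as y → R A x y
  rank-reflects as {x} {y} r with A.compare x y
  ... | tri< x<y _ _ = x<y
  ... | tri≈ _ refl _ = ⊥-elim (ℕₚ.<-irrefl refl r)
  ... | tri> _ _ y<x = ⊥-elim (ℕₚ.<⇒≱ r (rank-mono as y<x))

  insert : Carrier A → List (Carrier A) → List (Carrier A)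
  insert x []       = x ∷ []
  insert x (y ∷ ys) with x A.<? y
  ... | yes _ = x ∷ y ∷ ys
  ... | no  _ = y ∷ insert x ys

  ∈-insert⁻ : ∀ {x z} ys → z ∈ insert x ys → z ≡ x ⊎ z ∈ ys
  ∈-insert⁻ [] (here e) = inj₁ e
  ∈-insert⁻ {x} (y ∷ ys) p with x A.<? y | p
  ... | yes _ | here e  = inj₁ e
  ... | yes _ | there q = inj₂ q
  ... | no  _ | here e  = inj₂ (here e)
  ... | no  _ | there q with ∈-insert⁻ ys q
  ...   | inj₁ e = inj₁ e
  ...   | inj₂ r = inj₂ (there r)

  length-insert : ∀ x ys → length (insert x ys) ≡ suc (length ys)
  length-insert x []       = refl
  length-insert x (y ∷ ys) with x A.<? y
  ... | yes _ = refl
  ... | no  _ = cong suc (length-insert x ys)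

  insert-sorted : ∀ {x ys} → x ∉ ys → AllPairs (R A) ys → AllPairs (R A) (insert x ys)
  insert-sorted {ys = []} _ [] = [] ∷ []
  insert-sorted {x} {y ∷ ys} x∉ (y<ys ∷ s) with x A.<? y
  ... | yes x<y = (x<y ∷ All.map (A.trans x<y) y<ys) ∷ y<ys ∷ s
  ... | no  x≮y = All.tabulate y<ins ∷ insert-sorted (x∉ ∘ there) s
    where
    y<ins : ∀ {z} → z ∈ insert x ys → R A y z
    y<ins p with ∈-insert⁻ ys p
    ... | inj₂ q = All.lookup y<ys q
    ... | inj₁ refl with A.compare x y
    ...   | tri< x<y _ _  = ⊥-elim (x≮y x<y)
    ...   | tri≈ _ refl _ = ⊥-elim (x∉ (here refl))
    ...   | tri> _ _ y<x  = y<x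

  module _ (em : (P : Set) → Dec P) (S : Carrier A → Set) where

    Finite : Set
    Finite = ∃ λ xs → ∀ x → S x ⇔ x ∈ xs

    chain : ℕ → List (Carrier A)
    chain zero = []
    chain (suc n) with em (∃ λ x → S x × x ∉ chain n)
    ... | yes (x , _) = insert x (chain n)
    ... | no _ = chain n

    chain-⊆ : ∀ n {x} → x ∈ chain n → S x
    chain-⊆ (suc n) p with em (∃ λ x → S x × x ∉ chain n)
    ... | no _ = chain-⊆ n p
    ... | yes (_ , sx , _) with ∈-insert⁻ (chain n) p
    ...   | inj₁ refl = sx
    ...   | inj₂ q    = chain-⊆ n q

    chain-sorted : ∀ n → AllPairs (R A) (chain n)
    chain-sorted zero = []
    chain-sorted (suc n) with em (∃ λ x → S x × x ∉ chain n)
    ... | no _ = chain-sorted n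
    ... | yes (_ , _ , x∉) = insert-sorted x∉ (chain-sorted n)

    -- A stage at which nothing can be inserted would already list all of `S`.
    length-chain : ¬ Finite → ∀ n → length (chain n) ≡ n
    length-chain inf zero = refl
    length-chain inf (suc n) with em (∃ λ x → S x × x ∉ chain n)
    ... | yes (x , _) = trans (length-insert x (chain n)) (cong suc (length-chain inf n))
    ... | no full = ⊥-elim (inf (chain n , λ x → mk⇔ (in-chain x) (chain-⊆ n)))
      where
      in-chain : ∀ x → S x → x ∈ chain n
      in-chain x sx with em (x ∈ chain n)
      ... | yes p = p
      ... | no ¬p = ⊥-elim (full (x , sx , ¬p))

nth : {X : Set} → X → List X → ℕ → X
nth d []       _       = d
nth d (x ∷ xs) zero    = x
nth d (x ∷ xs) (suc i) = nth d xs i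

nth-∈ : ∀ {X : Set} {d : X} {xs i} → i < length xs → nth d xs i ∈ xs
nth-∈ {xs = x ∷ xs} {zero}  _       = here refl
nth-∈ {xs = x ∷ xs} {suc i} (s≤s p) = there (nth-∈ p)

-- The two defaults may differ because each placed point brings its own; within the length neither
-- is reached.
nth-mono : ∀ {X : Set} {_≺_ : X → X → Set} {d d′ : X} {xs i j} → AllPairs _≺_ xs →
  i < j → j < length xs → nth d xs i ≺ nth d′ xs j
nth-mono {i = zero}  {suc j} (x≺ ∷ _) _       (s≤s q) = All.lookup x≺ (nth-∈ q)
nth-mono {i = suc i} {suc j} (_ ∷ s)  (s≤s p) (s≤s q) = nth-mono s p q

-- Replacing every point outside a finite set by a copy of ℚ

module Inflation (em : (P : Set) → Dec P) (L : Structure) (sL : STO L) (F : List (Carrier L)) where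
  private
    module L = IsStrictTotalOrder sL

  -- A point over F has only the offset 0, so that no quotient is needed.
  anchor : Carrier L → ℚ → ℚ
  anchor x q = if does (em (x ∈ F)) then 0ℚ else q

  anchor-∈ : ∀ {x q} → x ∈ F → anchor x q ≡ 0ℚ
  anchor-∈ {x} x∈F with em (x ∈ F)
  ... | yes _  = refl
  ... | no x∉F = ⊥-elim (x∉F x∈F)

  anchor-∉ : ∀ {x q} → x ∉ F → anchor x q ≡ q
  anchor-∉ {x} x∉F with em (x ∈ F)
  ... | yes x∈F = ⊥-elim (x∉F x∈F)
  ... | no _    = refl

  anchor-0 : ∀ {x} → anchor x 0ℚ ≡ 0ℚ
  anchor-0 {x} with em (x ∈ F)
  ... | yes _ = refl
  ... | no _  = refl

  record Point : Set where
    constructor point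
    field
      base     : Carrier L
      off      : ℚ
      anchored : anchor base off ≡ off
  open Point public

  -- `anchored` is an equation between rationals, whose equality is decidable, so its proof is
  -- unique.
  point-≡ : ∀ {z z′} → base z ≡ base z′ → off z ≡ off z′ → z ≡ z′
  point-≡ {point x q p} {point .x .q p′} refl refl =
    cong (point x q) (Decidable⇒UIP.≡-irrelevant ℚₚ._≟_ p p′)

  data _≺_ (z z′ : Point) : Set where
    ≺-base : R L (base z) (base z′) → z ≺ z′
    ≺-off  : base z ≡ base z′ → off z ℚ.< off z′ → z ≺ z′

  N : Structure
  N = record
    { Carrier   = Point
    ; R         = _≺_
    ; countable = mk↣ {to = code} code-injective
    }
    where
    module c = Injection (countable L)
    code : Point → ℕ
    code z = pair (c.to (base z)) (ℚ-code (off z))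
    code-injective : ∀ {z z′} → code z ≡ code z′ → z ≡ z′
    code-injective {z} {z′} e
      with e₁ , e₂ ← pair-injective {c.to (base z)} {ℚ-code (off z)} {c.to (base z′)} {ℚ-code (off z′)} e
      = point-≡ (c.injective e₁) (ℚ-code-injective _ _ e₂)

  ≺-irrefl : ∀ {z} → ¬ z ≺ z
  ≺-irrefl (≺-base r)  = L.irrefl refl r
  ≺-irrefl (≺-off _ q) = ℚₚ.<-irrefl refl q

  ≺-trans : ∀ {x y z} → x ≺ y → y ≺ z → x ≺ z
  ≺-trans (≺-base r)  (≺-base s)   = ≺-base (L.trans r s)
  ≺-trans {x} (≺-base r)  (≺-off e _) = ≺-base (subst (R L (base x)) e r)
  ≺-trans {z = z} (≺-off e _) (≺-base s) = ≺-base (subst (λ b → R L b (base z)) (sym e) s)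
  ≺-trans (≺-off e p) (≺-off e′ q) = ≺-off (trans e e′) (ℚₚ.<-trans p q)

  ≺-asym : ∀ {x y} → x ≺ y → ¬ y ≺ x
  ≺-asym p q = ≺-irrefl (≺-trans p q)

  private
    less : ∀ {x y} → x ≺ y → Tri (x ≺ y) (x ≡ y) (y ≺ x)
    less p = tri< p (λ { refl → ≺-irrefl p }) (≺-asym p)

    more : ∀ {x y} → y ≺ x → Tri (x ≺ y) (x ≡ y) (y ≺ x)
    more p = tri> (≺-asym p) (λ { refl → ≺-irrefl p }) p

  ≺-compare : ∀ x y → Tri (x ≺ y) (x ≡ y) (y ≺ x)
  ≺-compare x y with L.compare (base x) (base y) | ℚₚ.<-cmp (off x) (off y)
  ... | tri< r _ _ | _          = less (≺-base r)
  ... | tri> _ _ r | _          = more (≺-base r)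
  ... | tri≈ _ e _ | tri< r _ _ = less (≺-off e r)
  ... | tri≈ _ e _ | tri> _ _ r = more (≺-off (sym e) r)
  ... | tri≈ _ e _ | tri≈ _ e′ _ with refl ← point-≡ {x} {y} e e′ = tri≈ ≺-irrefl refl ≺-irrefl

  sN : STO N
  sN = record
    { isStrictPartialOrder = record
      { isEquivalence = isEquivalence
      ; irrefl        = λ { refl → ≺-irrefl }
      ; trans         = ≺-trans
      ; <-resp-≈      = resp₂ _≺_
      }
    ; compare = ≺-compare
    }

  ι : Carrier L → Point
  ι x = point x 0ℚ anchor-0

  ι-base : ∀ z → base z ∈ F → ι (base z) ≡ z
  ι-base z x∈F = point-≡ refl (trans (sym (anchor-∈ x∈F)) (anchored z))

  private
    free : (x : Carrier L) → x ∉ F → ℚ → Point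
    free x x∉F q = point x q (anchor-∉ x∉F)

    p<p+1 : ∀ p → p ℚ.< p ℚ.+ 1ℚ
    p<p+1 p = subst (ℚ._< p ℚ.+ 1ℚ) (ℚₚ.+-identityʳ p) (ℚₚ.+-monoʳ-< p (ℚₚ.positive⁻¹ 1ℚ))

    p-1<p : ∀ p → p ℚ.- 1ℚ ℚ.< p
    p-1<p p = subst (p ℚ.- 1ℚ ℚ.<_) (ℚₚ.+-identityʳ p) (ℚₚ.+-monoʳ-< p (ℚₚ.negative⁻¹ (ℚ.- 1ℚ)))

    -- The fibre of `z` is a copy of ℚ. If the upper bound is absent or in a later fibre, adding 1
    -- to the offset stays below it; within the same fibre density applies.
    just-above : ∀ {z h} → base z ∉ F → Bounds N (just z) h → ∃ (Between N (just z) h)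
    just-above {z} x∉F ,+∞ = free (base z) x∉F (off z ℚ.+ 1ℚ) , ≺-off refl (p<p+1 (off z)) , tt
    just-above {z} x∉F (bnd (≺-base r)) =
      free (base z) x∉F (off z ℚ.+ 1ℚ) , ≺-off refl (p<p+1 (off z)) , ≺-base r
    just-above {z} x∉F (bnd (≺-off e q)) with m , l , u ← ℚₚ.<-dense q =
      free (base z) x∉F m , ≺-off refl l , ≺-off e u

    just-below : ∀ {l z} → base z ∉ F → Bounds N l (just z) → ∃ (Between N l (just z))
    just-below {z = z} x∉F -∞, = free (base z) x∉F (off z ℚ.- 1ℚ) , tt , ≺-off refl (p-1<p (off z))
    just-below {z = z} x∉F (bnd (≺-base r)) =
      free (base z) x∉F (off z ℚ.- 1ℚ) , ≺-base r , ≺-off refl (p-1<p (off z))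
    just-below {z = z} x∉F (bnd (≺-off e q)) with m , l , u ← ℚₚ.<-dense q =
      free (base z) x∉F m , ≺-off e l , ≺-off refl u

  -- Both ends of an empty gap lie over `F`, by `just-above` and `just-below`, and there `ι` inverts
  -- `base`. A point of `L` between their bases would lift through `ι` into the gap.
  reflectsEmpty : ReflectsEmpty L N (λ x z → x ∈ F × ι x ≡ z)
  reflectsEmpty {l} {h} b none =
    Maybe.map base l , Maybe.map base h , lower l b none , upper h b none ,
    λ (d , ld , dh) → none (ι d , lift-l l ld , lift-h h dh)
    where
    Base : Carrier L → Point → Set
    Base x z = x ∈ F × ι x ≡ z
    lower : ∀ l → Bounds N l h → Empty N l h → Pointwise Base (Maybe.map base l) l
    lower nothing _ _ = nothing
    lower (just z) b none with em (base z ∈ F)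
    ... | yes x∈F = just (x∈F , ι-base z x∈F)
    ... | no x∉F  = ⊥-elim (none (just-above x∉F b))
    upper : ∀ h → Bounds N l h → Empty N l h → Pointwise Base (Maybe.map base h) h
    upper nothing _ _ = nothing
    upper (just z) b none with em (base z ∈ F)
    ... | yes x∈F = just (x∈F , ι-base z x∈F)
    ... | no x∉F  = ⊥-elim (none (just-below x∉F b))
    lift-l : ∀ l {d} → Above L (Maybe.map base l) d → Above N l (ι d)
    lift-l nothing  _ = tt
    lift-l (just z) r = ≺-base r
    lift-h : ∀ h {d} → Above (op L) (Maybe.map base h) d → Above (op N) h (ι d)
    lift-h nothing  _ = tt
    lift-h (just z) r = ≺-base r

-- Finite and infinite order classes over a tuple

module Classes (em : (P : Set) → Dec P) (L : Structure) (sL : STO L) (as : List (Carrier L)) where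
  private
    module L = IsStrictTotalOrder sL
  open Chains L sL

  -- Points outside as have the same order type over as iff their ranks agree.
  class : ℕ → Carrier L → Set
  class r y = y ∉ as × rank as y ≡ r

  -- What the placement of points of the inflation requires of `F`: the classes left outside are
  -- infinite, and no element of `F` cuts them.
  record Saturated (F : List (Carrier L)) : Set where
    field
      as⊆F           : ∀ {x} → x ∈ as → x ∈ F
      class-infinite : ∀ {x} → x ∉ F → ¬ Finite em (class (rank as x))
      same-cut       : ∀ {x y f} → x ∉ F → class (rank as x) y → f ∈ F →
                       (R L f x → R L f y) × (R L x f → R L y f)

  fill : ℕ → List (Carrier L)
  fill r with em (Finite em (class r))
  ... | yes (xs , _) = xs
  ... | no _         = []

  F : List (Carrier L)
  -- Ranks run from 0 to `length as` inclusive, hence the `suc`.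
  F = as List.++ List.concatMap fill (List.upTo (suc (length as)))

  fill⁻ : ∀ {r x} → x ∈ fill r → class r x × Finite em (class r)
  fill⁻ {r} {x} p with em (Finite em (class r))
  ... | yes fin@(xs , e) = from (e x) p , fin

  fill⁺ : ∀ {r x} → Finite em (class r) → class r x → x ∈ fill r
  fill⁺ {r} {x} fin c with em (Finite em (class r))
  ... | yes (xs , e) = to (e x) c
  ... | no inf       = ⊥-elim (inf fin)

  as⊆F : ∀ {x} → x ∈ as → x ∈ F
  as⊆F = ∈-++⁺ˡ

  class-infinite : ∀ {x} → x ∉ F → ¬ Finite em (class (rank as x))
  class-infinite {x} x∉F fin =
    x∉F (∈-++⁺ʳ as (∈-concatMap⁺ fill (lose (∈-upTo⁺ (s≤s (rank≤length as x))) (fill⁺ fin (x∉F ∘ as⊆F , refl)))))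

  -- An `f` in `as` separating `x` from `y` would make their ranks differ. An `f` from a finite
  -- class has another rank than `x`, whose class is infinite, so the ranks alone decide the order,
  -- and `y` has the rank of `x`.
  same-cut : ∀ {x y f} → x ∉ F → class (rank as x) y → f ∈ F → (R L f x → R L f y) × (R L x f → R L y f)
  same-cut {x} {y} {f} x∉F (y∉as , e) f∈F with ∈-++⁻ as f∈F
  ... | inj₁ f∈as = below , above
    where
    below : R L f x → R L f y
    below f<x with L.compare f y
    ... | tri< f<y _ _  = f<y
    ... | tri≈ _ refl _ = ⊥-elim (y∉as f∈as)
    ... | tri> f≮y _ y<f = ⊥-elim (ℕₚ.<-irrefl e (rank-strict f∈as f≮y f<x (L.trans y<f f<x)))
    above : R L x f → R L y f
    above x<f with L.compare y f
    ... | tri< y<f _ _  = y<f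
    ... | tri≈ _ refl _ = ⊥-elim (y∉as f∈as)
    ... | tri> _ _ f<y = ⊥-elim (ℕₚ.<-irrefl (sym e)
      (rank-strict f∈as (λ f<x → L.irrefl refl (L.trans f<x x<f)) f<y (L.trans x<f f<y)))
  ... | inj₂ p with r , _ , q ← find (∈-concatMap⁻ fill {xs = List.upTo (suc (length as))} p)
    with (_ , e₀) , fin ← fill⁻ q = below , above
    where
    r≢ : rank as f ≢ rank as x
    r≢ e′ = class-infinite x∉F (subst (λ r → Finite em (class r)) (trans (sym e₀) e′) fin)
    below : R L f x → R L f y
    below f<x = rank-reflects as (subst (rank as f <_) (sym e) (ℕₚ.≤∧≢⇒< (rank-mono as f<x) r≢))
    above : R L x f → R L y f
    above x<f = rank-reflects as (subst (_< rank as f) (sym e) (ℕₚ.≤∧≢⇒< (rank-mono as x<f) (r≢ ∘ sym)))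

  saturated : Saturated F
  saturated = record { as⊆F = as⊆F ; class-infinite = class-infinite ; same-cut = same-cut }

-- Transfer of Π₂ formulas to the inflated order

module Placement (em : (P : Set) → Dec P) (L : Structure) (sL : STO L) {as F : List (Carrier L)}
  (sat : Classes.Saturated em L sL as F) where
  open Classes em L sL as using (class)
  open Classes.Saturated sat
  open Inflation em L sL F public
  open Chains L sL
  private
    module Nᶜ = Chains N sN

  module _ (zs : List Point) where

    -- A point over x ∉ F is sent into a chain of the class of x, at the position
    -- given by its rank in zs.  That chain depends only on the class, so points of
    -- one class keep their order.
    level : ℕ → List (Carrier L)
    -- Ranks in `zs` can reach `length zs`, so one more position is required.
    level r = chain em (class r) (suc (length zs))

    place : Point → Carrier L
    place z with em (base z ∈ F)
    ... | yes _ = base z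
    ... | no _  = nth (base z) (level (rank as (base z))) (Nᶜ.rank zs z)

    private
      rank<length : ∀ {z} → base z ∉ F → Nᶜ.rank zs z < length (level (rank as (base z)))
      rank<length {z} x∉F = subst (Nᶜ.rank zs z <_) (sym (length-chain em _ (class-infinite x∉F) _))
        (s≤s (Nᶜ.rank≤length zs z))

      nth-class : ∀ {z} → base z ∉ F →
        class (rank as (base z)) (nth (base z) (level (rank as (base z))) (Nᶜ.rank zs z))
      nth-class {z} x∉F = chain-⊆ em _ (suc (length zs)) (nth-∈ (rank<length {z} x∉F))

      level-mono : ∀ {d d′ r s i j} → r ≡ s → i < j → j < length (level s) →
        R L (nth d (level r) i) (nth d′ (level s) j)
      level-mono {r = r} refl = nth-mono (chain-sorted em (class r) (suc (length zs)))

      ≺⇒base : ∀ {z z′} → z ≺ z′ → R L (base z) (base z′) ⊎ base z ≡ base z′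
      ≺⇒base (≺-base r)  = inj₁ r
      ≺⇒base (≺-off e _) = inj₂ e

    place-∈ : ∀ {z} → base z ∈ F → place z ≡ base z
    place-∈ {z} x∈F with em (base z ∈ F)
    ... | yes _  = refl
    ... | no x∉F = ⊥-elim (x∉F x∈F)

    place-ι : ∀ {x} → x ∈ F → place (ι x) ≡ x
    place-ι {x} x∈F = place-∈ {ι x} x∈F

    -- Over `F` bases are kept, and `same-cut` handles the mixed cases. Outside `F`, different ranks
    -- separate whole classes; with equal ranks both points enter one chain, where `z`, being an
    -- entry of `zs` counted for `z′` but not for itself, gets the smaller position.
    place-mono : ∀ {z z′} → z ∈ zs → z ≺ z′ → R L (place z) (place z′)
    place-mono {z} {z′} z∈ z≺z′ with em (base z ∈ F) | em (base z′ ∈ F) | ≺⇒base z≺z′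
    ... | yes _   | yes _   | inj₁ r = r
    ... | yes x∈F | yes y∈F | inj₂ e =
      ⊥-elim (≺-irrefl (subst (_≺ z′) (trans (sym (ι-base z x∈F)) (trans (cong ι e) (ι-base z′ y∈F))) z≺z′))
    ... | yes x∈F | no y∉F  | inj₁ r = proj₁ (same-cut y∉F (nth-class {z′} y∉F) x∈F) r
    ... | yes x∈F | no y∉F  | inj₂ e = ⊥-elim (y∉F (subst (_∈ F) e x∈F))
    ... | no x∉F  | yes y∈F | inj₁ r = proj₂ (same-cut x∉F (nth-class {z} x∉F) y∈F) r
    ... | no x∉F  | yes y∈F | inj₂ e = ⊥-elim (x∉F (subst (_∈ F) (sym e) y∈F))
    ... | no x∉F  | no y∉F  | le with ℕₚ.m≤n⇒m<n∨m≡n (rank-≤ le)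
      where
      rank-≤ : R L (base z) (base z′) ⊎ base z ≡ base z′ → rank as (base z) ≤ rank as (base z′)
      rank-≤ (inj₁ r) = rank-mono as r
      rank-≤ (inj₂ e) = ℕₚ.≤-reflexive (cong (rank as) e)
    ...   | inj₁ r with _ , e ← nth-class {z} x∉F with _ , e′ ← nth-class {z′} y∉F =
      rank-reflects as (subst₂ _<_ (sym e) (sym e′) r)
    ...   | inj₂ e = level-mono e (Nᶜ.rank-strict z∈ ≺-irrefl z≺z′ z≺z′) (rank<length {z′} y∉F)

  -- A universal challenge in `N` is placed in `L`, answered there by a Σ₁ fact, and that fact is
  -- carried back along the finite partial isomorphism given by the placement.
  pi₂-transfer : ∀ {n m} → n ≤ 2 → {ρ : Vector (Carrier L) m} {ρ′ : Vector Point m} →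
    (∀ i → ρ i ∈ F × ι (ρ i) ≡ ρ′ i) → (π : Pi n m) → piSat L ρ π → piSat N ρ′ π
  pi₂-transfer _ {ρ} {ρ′} m (qfΠ φ) s =
    to (qf-transfer {L} {N} (Match-resp {L} {N} (λ _ → refl) (proj₂ ∘ m)
      (λ i j → mk⇔ ≺-base base-< , mk⇔ (cong ι) (cong base))) φ) s
    where
    base-< : ∀ {x y} → ι x ≺ ι y → R L x y
    base-< (≺-base r)  = r
    base-< (≺-off _ q) = ⊥-elim (ℚₚ.<-irrefl refl q)
  pi₂-transfer n≤2 {ρ} {ρ′} m (⋀∀ k β β≤ φ) s i v =
    sig₁-transfer em sL sN reflectsEmpty base-∈ cons (ℕₚ.≤-trans (β≤ i) (s≤s⁻¹ n≤2)) mem (φ i) (s i (place zs ∘ v))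
    where
    zs : List Point
    -- Including the images of `F` puts every pair of the base relation into `P`.
    zs = List.map ι F List.++ List.tabulate v
    P : List (Carrier L × Point)
    P = List.map (λ z → place zs z , z) zs
    base-∈ : ∀ {x z} → x ∈ F × ι x ≡ z → (x , z) ∈ P
    base-∈ {x} (x∈F , refl) = subst (λ y → (y , ι x) ∈ P) (place-ι zs x∈F)
      (∈-map⁺ (λ z → place zs z , z) (∈-++⁺ˡ (∈-map⁺ ι x∈F)))
    cons : Consistent L N P
    cons p q with z , z∈ , refl ← ∈-map⁻ _ p with z′ , z′∈ , refl ← ∈-map⁻ _ q =
      -- Placement is a map out of `N`, so consistency is shown in that direction and then inverted.
      Agree-flip {N} {L} (consistent {N} {L} sN sL {List.map (λ z → z , place zs z) zs} mono well (∈-map⁺ _ z∈) (∈-map⁺ _ z′∈))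
      where
      mono : ∀ {p q} → p ∈ List.map (λ z → z , place zs z) zs → q ∈ List.map (λ z → z , place zs z) zs →
        proj₁ p ≺ proj₁ q → R L (proj₂ p) (proj₂ q)
      mono p q r with z , z∈ , refl ← ∈-map⁻ _ p with z′ , _ , refl ← ∈-map⁻ _ q = place-mono zs z∈ r
      well : ∀ {p q} → p ∈ List.map (λ z → z , place zs z) zs → q ∈ List.map (λ z → z , place zs z) zs →
        proj₁ p ≡ proj₁ q → proj₂ p ≡ proj₂ q
      well p q e with z , z∈ , refl ← ∈-map⁻ _ p with z′ , _ , refl ← ∈-map⁻ _ q = cong (place zs) e
    mem : ∀ j → ((place zs ∘ v ++ ρ) j , (v ++ ρ′) j) ∈ P
    mem = ++⁺ (λ x z → (x , z) ∈ P) (λ j → ∈-map⁺ _ (∈-++⁺ʳ (List.map ι F) (∈-tabulate⁺ j))) (λ j → base-∈ (m j))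

-- From a Scott sentence to finitely many adjacencies

adjacencyFinite-≅ : A ≅ B → AdjacencyFinite A → AdjacencyFinite B
adjacencyFinite-≅ {A} {B} (f , pres) (xs , fin) = List.map f² xs , adj
  where
  open Bijection f renaming (to to f↑)
  f² : Carrier A × Carrier A → Carrier B × Carrier B
  f² (x , y) = f↑ x , f↑ y
  adj : ∀ a b → Adjacent B a b → (a , b) ∈ List.map f² xs
  adj a b (a<b , none) with x , fx ← surjective a | y , fy ← surjective b
    with refl ← fx refl | refl ← fy refl =
    ∈-map⁺ f² (fin x y (from (pres x y) a<b , λ (c , r , s) → none (f↑ c , to (pres x c) r , to (pres c y) s)))

≅-refl : A ≅ A
≅-refl = mk⤖ {to = id} (id , λ y → y , id) , λ _ _ → mk⇔ id id

scott⇒finite : ((P : Set) → Dec P) → (L : Structure) → STO L → HasΣ3ScottSentence L → AdjacencyFinite L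
-- `L` satisfies its own sentence; the disjunct true there, with its witnesses, decides which points
-- are kept fixed.
scott⇒finite em L sL (⋁∃ k β β≤ φ , scott) with i , v , s ← from (scott L) (≅-refl {L}) =
  adjacencyFinite-≅ {N} {L} (to (scott N) (i , ι ∘ v , pi₂-transfer (β≤ i) in-F (φ i) s))
    (reflectsEmpty⇒adjacencyFinite F ι reflectsEmpty)
  where
  as = List.tabulate v
  open Classes em L sL as using (F; saturated)
  open Placement em L sL saturated
  open Classes.Saturated saturated using (as⊆F)
  in-F : ∀ j → (v ++ emptyAssignment) j ∈ F × ι ((v ++ emptyAssignment) j) ≡ (ι ∘ v ++ emptyAssignment) j
  in-F = ++⁺ (λ x z → x ∈ F × ι x ≡ z) (λ j → as⊆F (∈-tabulate⁺ j) , refl) (λ ())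

-- Back and forth

module BackAndForth (em : (P : Set) → Dec P) (A B : Structure)
  (Good : List (Carrier A × Carrier B) → Set)
  (consistent : ∀ {P} → Good P → Consistent A B P)
  (start : Good [])
  (forth : ∀ {P} → Good P → ∀ x → ∃ λ y → Good ((x , y) ∷ P))
  (back  : ∀ {P} → Good P → ∀ y → ∃ λ x → Good ((x , y) ∷ P)) where
  private
    module a = Injection (countable A)
    module b = Injection (countable B)

  State : Set
  State = Σ (List (Carrier A × Carrier B)) Good

  forth-step back-step : ℕ → State → State
  forth-step n (P , g) with em (∃ λ x → a.to x ≡ n)
  ... | yes (x , _) = (x , proj₁ (forth g x)) ∷ P , proj₂ (forth g x)
  ... | no _        = P , g
  back-step n (P , g) with em (∃ λ y → b.to y ≡ n)
  ... | yes (y , _) = (proj₁ (back g y) , y) ∷ P , proj₂ (back g y)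
  ... | no _        = P , g

  forth-step-⊆ : ∀ n s {p} → p ∈ proj₁ s → p ∈ proj₁ (forth-step n s)
  forth-step-⊆ n (P , g) p with em (∃ λ x → a.to x ≡ n)
  ... | yes _ = there p
  ... | no _  = p

  back-step-⊆ : ∀ n s {p} → p ∈ proj₁ s → p ∈ proj₁ (back-step n s)
  back-step-⊆ n (P , g) p with em (∃ λ y → b.to y ≡ n)
  ... | yes _ = there p
  ... | no _  = p

  forth-step-∋ : ∀ x s → ∃ λ y → (x , y) ∈ proj₁ (forth-step (a.to x) s)
  forth-step-∋ x (P , g) with em (∃ λ x′ → a.to x′ ≡ a.to x)
  ... | no ¬∃ = ⊥-elim (¬∃ (x , refl))
  ... | yes (x′ , e) with refl ← a.injective e = _ , here refl

  back-step-∋ : ∀ y s → ∃ λ x → (x , y) ∈ proj₁ (back-step (b.to y) s)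
  back-step-∋ y (P , g) with em (∃ λ y′ → b.to y′ ≡ b.to y)
  ... | no ¬∃ = ⊥-elim (¬∃ (y , refl))
  ... | yes (y′ , e) with refl ← b.injective e = _ , here refl

  -- Stage `suc n` treats the elements with code `n` on both sides, so each element is met at the
  -- stage after its code.
  stage : ℕ → State
  stage zero    = [] , start
  stage (suc n) = back-step n (forth-step n (stage n))

  stage-mono : ∀ {m n p} → m ℕ.≤′ n → p ∈ proj₁ (stage m) → p ∈ proj₁ (stage n)
  stage-mono (ℕ.≤′-reflexive refl) p = p
  stage-mono {n = suc n} (ℕ.≤′-step le) p =
    back-step-⊆ n (forth-step n (stage n)) (forth-step-⊆ n (stage n) (stage-mono le p))

  Limit : Carrier A → Carrier B → Set
  Limit x y = ∃ λ n → (x , y) ∈ proj₁ (stage n)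

  -- The stages increase, so any two pairs of the limit already occur together in one consistent
  -- stage.
  limit : IsoRel A B Limit
  limit = record
    { total = λ x → let n = a.to x; y , p = forth-step-∋ x (stage n) in
        y , suc n , back-step-⊆ n (forth-step n (stage n)) p
    ; onto  = λ y → let n = b.to y; x , p = back-step-∋ y (forth-step n (stage n)) in
        x , suc n , p
    ; agree = λ (m , p) (n , q) → consistent (proj₂ (stage (m ⊔ n)))
        (stage-mono (ℕₚ.≤⇒≤′ (ℕₚ.m≤m⊔n m n)) p) (stage-mono (ℕₚ.≤⇒≤′ (ℕₚ.m≤n⊔m m n)) q)
    }

-- Enumerations and quantifier-free types

module _ (em : (P : Set) → Dec P) {X : Set} (code : X → ℕ) (code-injective : ∀ {x y} → code x ≡ code y → x ≡ y) where

  -- Numbers that code nothing are padded with `nothing`. Index 0 is reserved for it, so that the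
  -- disjunct attached to `nothing` has a known index.
  enumerate : ℕ → Maybe X
  enumerate zero = nothing
  enumerate (suc n) with em (∃ λ x → code x ≡ n)
  ... | yes (x , _) = just x
  ... | no _        = nothing

  enumerate-onto : ∀ x → ∃ λ n → enumerate n ≡ x
  enumerate-onto nothing = zero , refl
  enumerate-onto (just x) = suc (code x) , lemma
    where
    lemma : enumerate (suc (code x)) ≡ just x
    lemma with em (∃ λ y → code y ≡ code x)
    ... | yes (y , e) = cong just (code-injective e)
    ... | no ¬∃       = ⊥-elim (¬∃ (x , refl))

module _ (em : (P : Set) → Dec P) where

  literal : ∀ {m} → Set → QF m → QF m
  literal P φ with em P
  ... | yes _ = φ
  ... | no _  = ¬ᶠ φ

  literal-sat : ∀ (M : Structure) {m} {ρ : Vector (Carrier M) m} {P} φ →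
    qfSat M ρ (literal P φ) ⇔ (P ⇔ qfSat M ρ φ)
  literal-sat M {P = P} φ with em P
  ... | yes p = mk⇔ (λ s → mk⇔ (λ _ → s) (λ _ → p)) (λ e → to e p)
  ... | no ¬p = mk⇔ (λ s → mk⇔ (⊥-elim ∘ ¬p) (⊥-elim ∘ s)) (λ e s → ¬p (from e s))

  ⋀ : ∀ {n m} → (Fin n → QF m) → QF m
  ⋀ {zero}  φ = ⊤ᶠ
  ⋀ {suc n} φ = φ zero ∧ᶠ ⋀ (φ ∘ suc)

  ⋀-sat : ∀ (M : Structure) {n m} {ρ : Vector (Carrier M) m} (φ : Fin n → QF m) →
    qfSat M ρ (⋀ φ) ⇔ (∀ i → qfSat M ρ (φ i))
  ⋀-sat M {zero}  φ = mk⇔ (λ _ ()) (λ _ → tt)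
  ⋀-sat M {suc n} φ = let e = ⋀-sat M (φ ∘ suc) in
    mk⇔ (λ { (s , t) zero → s ; (s , t) (suc i) → to e t i })
        (λ s → s zero , from e (s ∘ suc))

  module _ (L : Structure) where

    pair-type : ∀ {n m} → Vector (Carrier L) n → Vector (Fin m) n → Fin n → Fin n → QF m
    pair-type ρ σ i j =
      literal (R L (ρ i) (ρ j)) (lt (σ i) (σ j)) ∧ᶠ literal (ρ i ≡ ρ j) (eq (σ i) (σ j))

    -- The complete quantifier-free type of `ρ`, its entries named by the variables `σ`. The
    -- renaming allows a premise to skip a newly bound variable.
    type : ∀ {n m} → Vector (Carrier L) n → Vector (Fin m) n → QF m
    type ρ σ = ⋀ λ i → ⋀ (pair-type ρ σ i)

    type-sat : ∀ (M : Structure) {n m} (ρ : Vector (Carrier L) n) (σ : Vector (Fin m) n)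
      {τ : Vector (Carrier M) m} → qfSat M τ (type ρ σ) ⇔ Match L M ρ (τ ∘ σ)
    type-sat M ρ σ {τ} = mk⇔
      (λ s i j → let t , u = to (columns i) (to rows s i) j in
        to (literal-sat M (lt (σ i) (σ j))) t , to (literal-sat M (eq (σ i) (σ j))) u)
      (λ m → from rows λ i → from (columns i) λ j →
        from (literal-sat M (lt (σ i) (σ j))) (proj₁ (m i j)) ,
        from (literal-sat M (eq (σ i) (σ j))) (proj₂ (m i j)))
      where
      rows = ⋀-sat M {ρ = τ} (λ i → ⋀ (pair-type ρ σ i))
      columns = λ i → ⋀-sat M {ρ = τ} (pair-type ρ σ i)

-- Scott sentences of homogeneous structures

-- Homogeneity over `a` in its one-point extension form, which is what a single back-and-forth step
-- uses.
Homogeneous : (L : Structure) → ∀ {m} → Vector (Carrier L) m → Set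
Homogeneous L {m} a = ∀ {n} (c d : Vector (Carrier L) n) →
  Match L L (c ++ a) (d ++ a) → ∀ x → ∃ λ y → Match L L (x VF.∷ (c ++ a)) (y VF.∷ (d ++ a))

module _ {X : Set} {m} (a : Vector X m) where
  1-++ : ∀ {v : Vector X 1} i → (v zero VF.∷ a) i ≡ (v ++ a) i
  1-++ zero    = refl
  1-++ (suc i) = refl

  suc-++ : ∀ {n} (v : Vector X (suc n)) i → (v zero VF.∷ (v ∘ suc ++ a)) i ≡ (v ++ a) i
  suc-++     v zero    = refl
  suc-++ {n} v (suc i) with splitAt n i
  ... | inj₁ _ = refl
  ... | inj₂ _ = refl

module Scott (em : (P : Set) → Dec P) (L : Structure) {m} (a : Vector (Carrier L) m) where

  -- Indices for the conjuncts of the theory. Tuples are `Vec`s so that equal codes give equal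
  -- tuples, which makes the indices countable.
  data Axiom : Set where
    forthᴬ : ∀ {n} → Vec (Carrier L) n → Carrier L → Axiom
    backᴬ  : ∀ {n} → Vec (Carrier L) n → Axiom

  private
    module c = Injection (countable L)
    vc : ∀ {n} → Vec (Carrier L) n → ℕ
    vc = vec-code c.to

  axiom-code : Axiom → ℕ
  -- The `suc` keeps these codes apart from the `backᴬ` codes, which start with 0.
  axiom-code (forthᴬ {n} c x) = pair (suc (c.to x)) (pair n (vc c))
  axiom-code (backᴬ {n} c)    = pair 0 (pair n (vc c))

  axiom-code-injective : ∀ {α β} → axiom-code α ≡ axiom-code β → α ≡ β
  axiom-code-injective {forthᴬ {n} c x} {forthᴬ {n′} d y} e
    with e₁ , e₂ ← pair-injective {suc (c.to x)} {pair n (vc c)} {suc (c.to y)} {pair n′ (vc d)} e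
    with refl , e₃ ← pair-injective {n} {vc c} {n′} {vc d} e₂
    = cong₂ forthᴬ (vec-code-injective c.to c.injective c d e₃) (c.injective (ℕₚ.suc-injective e₁))
  axiom-code-injective {forthᴬ {n} c x} {backᴬ {n′} d} e
    with () ← proj₁ (pair-injective {suc (c.to x)} {pair n (vc c)} {0} {pair n′ (vc d)} e)
  axiom-code-injective {backᴬ {n} c} {forthᴬ {n′} d y} e
    with () ← proj₁ (pair-injective {0} {pair n (vc c)} {suc (c.to y)} {pair n′ (vc d)} e)
  axiom-code-injective {backᴬ {n} c} {backᴬ {n′} d} e
    with refl , e₃ ← pair-injective {n} {vc c} {n′} {vc d} (proj₂ (pair-injective {0} {pair n (vc c)} {0} {pair n′ (vc d)} e))
    = cong backᴬ (vec-code-injective c.to c.injective c d e₃)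

  axioms : ℕ → Maybe Axiom
  axioms = enumerate em axiom-code axiom-code-injective

  elements : ℕ → Maybe (Carrier L)
  elements = enumerate em c.to c.injective

  ⟦_⟧ : ∀ {n} → Vec (Carrier L) n → Vector (Carrier L) (n ℕ.+ m)
  ⟦ c ⟧ = Vec.lookup c ++ a

  -- Implications ⟨type of c⟩ → ∃ … and ⟨type of c⟩ → ⋁ …, with the negated premise
  -- as one of the disjuncts.
  forth-case : ∀ {n} → Vec (Carrier L) n → Carrier L → ℕ → Σ ℕ λ k → QF (k ℕ.+ (n ℕ.+ m))
  forth-case c x zero    = 0 , ¬ᶠ (type em L ⟦ c ⟧ id)
  forth-case c x (suc _) = 1 , type em L (x VF.∷ ⟦ c ⟧) id

  back-case : ∀ {n} → Vec (Carrier L) n → Maybe (Carrier L) → QF (suc n ℕ.+ m)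
  -- Variable 0 is the element to be matched; the premise concerns the variables after it.
  back-case c nothing  = ¬ᶠ (type em L ⟦ c ⟧ suc)
  back-case c (just x) = type em L (x VF.∷ ⟦ c ⟧) id

  ⋁∃QF : ∀ {m} → (ℕ → Σ ℕ λ k → QF (k ℕ.+ m)) → Sig 1 m
  ⋁∃QF φ = ⋁∃ (proj₁ ∘ φ) (const 0) (λ _ → z≤n) (λ i → qfΠ (proj₂ (φ i)))

  -- The universal block is the tuple, preceded for `backᴬ` by the element to be matched. `nothing`
  -- carries the requirement that the parameters have the type of `a`. All matrices are Σ₁, so the
  -- conjunction is Π₂.
  formula : Maybe Axiom → Σ ℕ λ k → Sig 1 (k ℕ.+ m)
  formula nothing                 = 0 , ⋁∃QF (λ _ → 0 , type em L a id)
  formula (just (forthᴬ {n} c x)) = n , ⋁∃QF (forth-case c x)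
  formula (just (backᴬ {n} c))    = suc n , ⋁∃QF (λ i → 0 , back-case c (elements i))

  theory : Pi 2 m
  theory = ⋀∀ (λ i → proj₁ (formula (axioms i))) (const 1) (λ _ → s≤s z≤n) (λ i → proj₂ (formula (axioms i)))

  module _ (M : Structure) (b : Vector (Carrier M) m) where

    Forth Back : Set
    Forth = ∀ {n} (c : Vec (Carrier L) n) (d : Vector (Carrier M) n) → Match L M ⟦ c ⟧ (d ++ b) →
      ∀ x → ∃ λ y → Match L M (x VF.∷ ⟦ c ⟧) (y VF.∷ (d ++ b))
    Back = ∀ {n} (c : Vec (Carrier L) n) (d : Vector (Carrier M) n) → Match L M ⟦ c ⟧ (d ++ b) →
      ∀ y → ∃ λ x → Match L M (x VF.∷ ⟦ c ⟧) (y VF.∷ (d ++ b))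

    record Extendable : Set where
      field
        base-match : Match L M a b
        forth      : Forth
        back       : Back

    private
      Holds : Maybe Axiom → Set
      Holds α = ∀ (v : Vector (Carrier M) (proj₁ (formula α))) → sigSat M (v ++ b) (proj₂ (formula α))

      holds : piSat M b theory → ∀ α → Holds α
      holds s α with i , e ← enumerate-onto em axiom-code axiom-code-injective α = subst Holds e (s i)

    theory⇒extendable : piSat M b theory → Extendable
    theory⇒extendable s = record
      { base-match = let _ , _ , t = holds s nothing (λ ()) in to (type-sat em L M a id) t
      ; forth = forth
      ; back = back
      }
      where
      forth : Forth
      forth c d cd x with holds s (just (forthᴬ c x)) d
      ... | zero  , _ , t = ⊥-elim (t (from (type-sat em L M ⟦ c ⟧ id) cd))
      ... | suc _ , v , t = v zero , Match-resp {L} {M} (λ _ → refl) (λ i → sym (1-++ (d ++ b) i))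
        (to (type-sat em L M (x VF.∷ ⟦ c ⟧) id) t)
      back : Back
      back c d cd y with i , _ , t ← holds s (just (backᴬ c)) (y VF.∷ d) with elements i
      ... | nothing = ⊥-elim (t (from (type-sat em L M ⟦ c ⟧ suc)
        (Match-resp {L} {M} (λ _ → refl) (λ i → suc-++ b (y VF.∷ d) (suc i)) cd)))
      ... | just x = x , Match-resp {L} {M} (λ _ → refl) (λ i → sym (suc-++ b (y VF.∷ d) i))
        (to (type-sat em L M (x VF.∷ ⟦ c ⟧) id) t)

    -- Excluded middle decides each premise: a false one makes disjunct 0 true, a true one is met by
    -- the extension property.
    extendable⇒theory : Extendable → piSat M b theory
    extendable⇒theory E i = proof (axioms i)
      where
      open Extendable E
      proof : ∀ α → Holds α
      proof nothing v = 0 , (λ ()) , from (type-sat em L M a id) base-match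
      proof (just (forthᴬ c x)) d with em (Match L M ⟦ c ⟧ (d ++ b))
      ... | no ¬cd = 0 , (λ ()) , λ t → ¬cd (to (type-sat em L M ⟦ c ⟧ id) t)
      ... | yes cd with y , xy ← forth c d cd x = 1 , (λ _ → y) ,
        from (type-sat em L M (x VF.∷ ⟦ c ⟧) id) (Match-resp {L} {M} (λ _ → refl) (1-++ (d ++ b)) xy)
      proof (just (backᴬ c)) u with em (Match L M ⟦ c ⟧ (u ∘ suc ++ b))
      ... | no ¬cu = 0 , (λ ()) , λ t → ¬cu (Match-resp {L} {M} (λ _ → refl)
        (λ i → sym (suc-++ b u (suc i))) (to (type-sat em L M ⟦ c ⟧ suc) t))
      ... | yes cu with x , xy ← back c (u ∘ suc) cu (u zero)
        with i , e ← enumerate-onto em c.to c.injective (just x) =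
        i , (λ ()) , subst (λ z → qfSat M (u ++ b) (back-case c z)) (sym e)
          (from (type-sat em L M (x VF.∷ ⟦ c ⟧) id) (Match-resp {L} {M} (λ _ → refl) (suc-++ b u) xy))

    extendable⇒iso : Extendable → ∃ (IsoRel L M)
    extendable⇒iso E = BF.Limit , BF.limit
      where
      open Extendable E
      left : (P : List (Carrier L × Carrier M)) → Vec (Carrier L) (length P)
      left P = Vec.map proj₁ (Vec.fromList P)
      right : (P : List (Carrier L × Carrier M)) → Vector (Carrier M) (length P)
      right P = Vec.lookup (Vec.map proj₂ (Vec.fromList P))
      -- The parameters are appended rather than listed in `P`, so the empty list is good by
      -- `base-match`.
      Good : List (Carrier L × Carrier M) → Set
      Good P = Match L M ⟦ left P ⟧ (right P ++ b)
      grow : ∀ {P x y} → Match L M (x VF.∷ ⟦ left P ⟧) (y VF.∷ (right P ++ b)) → Good ((x , y) ∷ P)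
      grow {P} {x} {y} = Match-resp {L} {M} (suc-++ a (Vec.lookup (left ((x , y) ∷ P)))) (suc-++ b (right ((x , y) ∷ P)))
      position : ∀ {P p} → p ∈ P → ∃ λ i → p ≡ (⟦ left P ⟧ i , (right P ++ b) i)
      position {_ ∷ _} (here refl) = zero , refl
      position {(x , y) ∷ P} (there p) with i , e ← position p =
        suc i , trans e (cong₂ _,_ (suc-++ a (Vec.lookup (left ((x , y) ∷ P))) (suc i)) (suc-++ b (right ((x , y) ∷ P)) (suc i)))
      consistentᴳ : ∀ {P} → Good P → Consistent L M P
      consistentᴳ g p q with i , refl ← position p with j , refl ← position q = g i j
      forthᴳ : ∀ {P} → Good P → ∀ x → ∃ λ y → Good ((x , y) ∷ P)
      forthᴳ {P} g x = let y , g′ = forth (left P) (right P) g x in y , grow {P} g′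
      backᴳ : ∀ {P} → Good P → ∀ y → ∃ λ x → Good ((x , y) ∷ P)
      backᴳ {P} g y = let x , g′ = back (left P) (right P) g y in x , grow {P} g′
      module BF = BackAndForth em L M Good consistentᴳ base-match (λ {P} → forthᴳ {P}) (λ {P} → backᴳ {P})

  -- With `L` on both sides, a back step is a forth step with the tuples exchanged.
  homogeneous⇒extendable : Homogeneous L a → Extendable L a
  homogeneous⇒extendable hom = record
    { base-match = λ _ _ → mk⇔ id id , mk⇔ id id
    ; forth = λ c d cd x → hom (Vec.lookup c) d cd x
    ; back = λ c d cd y → let x , m = hom d (Vec.lookup c) (λ i j → Agree-flip {L} {L} (cd i j)) y in
        x , λ i j → Agree-flip {L} {L} (m i j)
    }

homogeneous⇒scott : ((P : Set) → Dec P) → (L : Structure) → ∀ {m} (v : Vector (Carrier L) m) →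
  Homogeneous L (v ++ emptyAssignment) → HasΣ3ScottSentence L
homogeneous⇒scott em L {m} v hom = φ , λ M → mk⇔ (to-iso M) (from-iso M)
  where
  open Scott em L (v ++ emptyAssignment)
  φ : Sig 3 zero
  -- A single existential formula, repeated at every index.
  φ = ⋁∃ (const m) (const 2) (λ _ → ℕₚ.≤-refl) (const theory)
  to-iso : ∀ M → M ⊨ φ → M ≅ L
  to-iso M (_ , _ , s) = IsoRel⇒≅ (IsoRel-flip (proj₂ (extendable⇒iso M _ (theory⇒extendable M _ s))))
  L⊨φ : L ⊨ φ
  L⊨φ = 0 , v , extendable⇒theory L _ (homogeneous⇒extendable hom)
  from-iso : ∀ M → M ≅ L → M ⊨ φ
  from-iso M I = sig-iso (IsoRel-flip (≅⇒IsoRel {M} {L} I)) (λ ()) φ L⊨φ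

-- Homogeneity from finitely many adjacencies

finite⇒homogeneous : ((P : Set) → Dec P) → (L : Structure) → STO L → AdjacencyFinite L →
  ∃ λ (as : List (Carrier L)) → Homogeneous L (List.lookup as ++ emptyAssignment)
finite⇒homogeneous em L sL (xs , adj) = as , hom
  where
  ends : (Carrier L → Carrier L → Set) → List (Carrier L)
  ends _<_ with em (∃ λ x → ∀ y → ¬ y < x)
  ... | yes (x , _) = x ∷ []
  ... | no _        = []
  -- Two minimal elements are incomparable, hence equal, so the one chosen by `ends` is the given
  -- one.
  ends-∋ : ∀ {_<_} → (∀ {x y} → ¬ x < y → ¬ y < x → x ≡ y) → ∀ {x} → (∀ y → ¬ y < x) → x ∈ ends _<_
  ends-∋ {_<_} conn {x} min with em (∃ λ x → ∀ y → ¬ y < x)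
  ... | yes (x′ , min′) = here (conn (min′ x) (min x′))
  ... | no ¬∃           = ⊥-elim (¬∃ (x , min))
  as : List (Carrier L)
  as = ends (R L) List.++ ends (flip (R L)) List.++ List.map proj₁ xs List.++ List.map proj₂ xs
  conn : ∀ {x y} → ¬ R L x y → ¬ R L y x → x ≡ y
  conn {x} {y} x≮y y≮x with IsStrictTotalOrder.compare sL x y
  ... | tri< x<y _ _ = ⊥-elim (x≮y x<y)
  ... | tri≈ _ e _   = e
  ... | tri> _ _ y<x = ⊥-elim (y≮x y<x)
  least-∈ : ∀ {x} → (∀ y → ¬ R L y x) → x ∈ as
  least-∈ min = ∈-++⁺ˡ (ends-∋ conn min)
  greatest-∈ : ∀ {x} → (∀ y → ¬ R L x y) → x ∈ as
  greatest-∈ max = ∈-++⁺ʳ (ends (R L)) (∈-++⁺ˡ (ends-∋ (flip conn) max))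
  adjacent-∈ : ∀ {x y} → Adjacent L x y → x ∈ as × y ∈ as
  adjacent-∈ xy =
    ∈-++⁺ʳ (ends (R L)) (∈-++⁺ʳ (ends (flip (R L))) (∈-++⁺ˡ (∈-map⁺ proj₁ (adj _ _ xy)))) ,
    ∈-++⁺ʳ (ends (R L)) (∈-++⁺ʳ (ends (flip (R L))) (∈-++⁺ʳ (List.map proj₁ xs) (∈-map⁺ proj₂ (adj _ _ xy))))
  Base : Carrier L → Carrier L → Set
  Base x y = x ∈ as × x ≡ y
  -- An empty gap without a lower bound makes its upper end least, one without an upper bound makes
  -- its lower end greatest, and one with both is an adjacency; `as` contains all such points.
  H : ReflectsEmpty L L Base
  H {nothing} {nothing} _ none = nothing , nothing , nothing , nothing , none
  H {nothing} {just y} _ none = nothing , just y , nothing , just (least-∈ (λ z r → none (z , tt , r)) , refl) , none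
  H {just x} {nothing} _ none = just x , nothing , just (greatest-∈ (λ z r → none (z , r , tt)) , refl) , nothing , none
  H {just x} {just y} (bnd x<y) none with x∈ , y∈ ← adjacent-∈ (x<y , none) =
    just x , just y , just (x∈ , refl) , just (y∈ , refl) , none
  -- Both tuples end in `as`, so their graph contains the diagonal on `as` and a single use of
  -- `extend` suffices.
  hom : Homogeneous L (List.lookup as ++ emptyAssignment)
  hom {n} c d m x = let y , cons = extend em sL sL H P base consP x in y , match cons
    where
    ρ ρ′ : Vector (Carrier L) (n ℕ.+ (length as ℕ.+ 0))
    ρ  = c ++ (List.lookup as ++ emptyAssignment)
    ρ′ = d ++ (List.lookup as ++ emptyAssignment)
    P : List (Carrier L × Carrier L)
    P = List.tabulate (λ i → ρ i , ρ′ i)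
    base : ∀ {x y} → Base x y → (x , y) ∈ P
    base {x} (x∈ , refl) = subst (_∈ P) (cong₂ _,_ (here-in c) (here-in d)) (∈-tabulate⁺ k)
      where
      k : Fin (n ℕ.+ (length as ℕ.+ 0))
      k = n ↑ʳ (index x∈ ↑ˡ 0)
      here-in : (u : Vector (Carrier L) n) → (u ++ (List.lookup as ++ emptyAssignment)) k ≡ x
      here-in u = trans (lookup-++ʳ u _ (index x∈ ↑ˡ 0))
        (trans (lookup-++ˡ (List.lookup as) emptyAssignment (index x∈)) (sym (lookup-index x∈)))
    consP : Consistent L L P
    consP p q with i , refl ← ∈-tabulate⁻ p with j , refl ← ∈-tabulate⁻ q = m i j
    match : ∀ {y} → Consistent L L ((x , y) ∷ P) → Match L L (x VF.∷ ρ) (y VF.∷ ρ′)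
    match cons i j = cons (mem i) (mem j)
      where
      mem : ∀ i → ((x VF.∷ ρ) i , (_ VF.∷ ρ′) i) ∈ ((x , _) ∷ P)
      mem zero = here refl
      mem (suc i) = there (∈-tabulate⁺ i)

mainTheorem9 : ((P : Set) → Dec P) →
    (L : Structure) → IsStrictTotalOrder _≡_ (R L) →
    HasΣ3ScottSentence L ⇔ AdjacencyFinite L
mainTheorem9 em L sL = mk⇔ (scott⇒finite em L sL)
  (λ fin → let as , hom = finite⇒homogeneous em L sL fin in homogeneous⇒scott em L (List.lookup as) hom)
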